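{- The number of order-different $k$-XOS functions on $V=[n]$ (i.e., the number of order-equivalence classes of $k$-XOS functions $f\colon 2^{[n]}\to\mathbb{R}$) is $2^{O(k^2n^2)}$.
   Context: A set function $g\colon 2^V\to\mathbb{R}$ is additive if $g(X)=\sum_{v\in X}g(\{v\})$ for all $X\subseteq V$. For an integer $k\ge1$, a function $f\colon 2^V\to\mathbb{R}$ is $k$-XOS if there are additive functions $f_1,\dots,f_k\colon 2^V\to\mathbb{R}$ (values may be negative) with $f(X)=\max_{i\in[k]}f_i(X)$ for all $X\subseteq V$. Two set functions $f,g\colon 2^V\to\mathbb{R}$ are order-equivalent if for all $X,Y\subseteq V$, $f(X)\le f(Y)$ if and only if $g(X)\le g(Y)$; otherwise they are order-different. -}

module Defs where

open import Data.Fin.Base using (Fin; zero; suc)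
open import Data.Fin.Subset using (Subset; inside; outside; ⁅_⁆)
open import Data.Nat.Base as ℕ using (ℕ; zero; suc; NonZero)
import Data.Nat.Properties as ℕ
open import Data.Product.Base using (Σ-syntax; ∃-syntax; _×_; _,_)
open import Data.Rational.Base as ℚ using (ℚ; 0ℚ; ½)
import Data.Rational.Properties as ℚ
open import Data.Rational.Solver using (module +-*-Solver)
open import Data.Sum.Base using (inj₁; inj₂)
open import Data.Vec.Base using ([]; _∷_)
open import Data.Vec.Functional using (head; tail; foldr)
open import Function.Base using (_∘_)
open import Function.Bundles using (_⇔_)
open import Relation.Binary.PropositionalEquality
  using (_≡_; _≢_; refl; sym; trans; cong; subst; subst₂)
open import Relation.Nullary.Negation.Core using (¬_)

-- Real numbers: Cauchy sequences of rationals, with equality _≃ᵣ_.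

Cauchy : (ℕ → ℚ) → Set
Cauchy s = ∀ ε → 0ℚ ℚ.< ε →
  ∃[ N ] (∀ m n → N ℕ.≤ m → N ℕ.≤ n → ℚ.∣ s m ℚ.- s n ∣ ℚ.< ε)

record ℝ : Set where
  constructor mkℝ
  field
    seq    : ℕ → ℚ
    cauchy : Cauchy seq

open ℝ public

infix  4 _≤ᵣ_ _≃ᵣ_
infixl 6 _+ᵣ_ _⊔ᵣ_

_≤ᵣ_ : ℝ → ℝ → Set
x ≤ᵣ y = ∀ ε → 0ℚ ℚ.< ε →
  ∃[ N ] (∀ n → N ℕ.≤ n → seq x n ℚ.≤ seq y n ℚ.+ ε)

_≃ᵣ_ : ℝ → ℝ → Set
x ≃ᵣ y = x ≤ᵣ y × y ≤ᵣ x

0ᵣ : ℝ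
0ᵣ = mkℝ (λ _ → 0ℚ) (λ ε 0<ε → 0 , λ _ _ _ _ → 0<ε)

private
  ½-pos : ∀ {ε} → 0ℚ ℚ.< ε → 0ℚ ℚ.< ½ ℚ.* ε
  ½-pos = ℚ.*-monoʳ-<-pos ½

  ½+½ : ∀ ε → ½ ℚ.* ε ℚ.+ ½ ℚ.* ε ≡ ε
  ½+½ ε = trans (sym (ℚ.*-distribʳ-+ ε ½ ½)) (ℚ.*-identityˡ ε)

  +-minus-interchange : ∀ a b c d →
    (a ℚ.+ b) ℚ.- (c ℚ.+ d) ≡ (a ℚ.- c) ℚ.+ (b ℚ.- d)
  +-minus-interchange =
    solve 4 (λ a b c d → (a :+ b) :- (c :+ d) := (a :- c) :+ (b :- d)) refl
    where open +-*-Solver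

  minus-swap : ∀ p q → ℚ.- (p ℚ.- q) ≡ q ℚ.- p
  minus-swap = solve 2 (λ p q → :- (p :- q) := q :- p) refl
    where open +-*-Solver

  p≤∣p∣ : ∀ p → p ℚ.≤ ℚ.∣ p ∣
  p≤∣p∣ p with ℚ.≤-total 0ℚ p
  ... | inj₁ 0≤p = ℚ.≤-reflexive (sym (ℚ.0≤p⇒∣p∣≡p 0≤p))
  ... | inj₂ p≤0 = ℚ.≤-trans p≤0 (ℚ.0≤∣p∣ p)

  ∣-∣<-intro : ∀ {p q ε} → p ℚ.- q ℚ.< ε → q ℚ.- p ℚ.< ε → ℚ.∣ p ℚ.- q ∣ ℚ.< ε
  ∣-∣<-intro {p} {q} {ε} h₁ h₂ with ℚ.∣p∣≡p∨∣p∣≡-p (p ℚ.- q)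
  ... | inj₁ eq = subst (ℚ._< ε) (sym eq) h₁
  ... | inj₂ eq = subst (ℚ._< ε) (sym (trans eq (minus-swap p q))) h₂

  ∣-∣<-elimˡ : ∀ p q {ε} → ℚ.∣ p ℚ.- q ∣ ℚ.< ε → p ℚ.- q ℚ.< ε
  ∣-∣<-elimˡ p q = ℚ.≤-<-trans (p≤∣p∣ (p ℚ.- q))

  ∣-∣<-elimʳ : ∀ p q {ε} → ℚ.∣ p ℚ.- q ∣ ℚ.< ε → q ℚ.- p ℚ.< ε
  ∣-∣<-elimʳ p q {ε} h = subst (ℚ._< ε) (minus-swap p q)
    (ℚ.≤-<-trans (p≤∣p∣ _) (subst (ℚ._< ε) (sym (ℚ.∣-p∣≡∣p∣ (p ℚ.- q))) h))

  ⊔-minus-< : ∀ a b c d {ε} → a ℚ.- c ℚ.< ε → b ℚ.- d ℚ.< ε →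
    (a ℚ.⊔ b) ℚ.- (c ℚ.⊔ d) ℚ.< ε
  ⊔-minus-< a b c d {ε} h₁ h₂ with ℚ.⊔-sel a b
  ... | inj₁ eq = subst (λ t → t ℚ.- (c ℚ.⊔ d) ℚ.< ε) (sym eq)
    (ℚ.≤-<-trans (ℚ.+-monoʳ-≤ a (ℚ.neg-antimono-≤ (ℚ.p≤p⊔q c d))) h₁)
  ... | inj₂ eq = subst (λ t → t ℚ.- (c ℚ.⊔ d) ℚ.< ε) (sym eq)
    (ℚ.≤-<-trans (ℚ.+-monoʳ-≤ b (ℚ.neg-antimono-≤ (ℚ.p≤q⊔p c d))) h₂)

_+ᵣ_ : ℝ → ℝ → ℝ
seq    (x +ᵣ y) n = seq x n ℚ.+ seq y n
cauchy (x +ᵣ y) ε 0<ε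
  with cauchy x (½ ℚ.* ε) (½-pos 0<ε) | cauchy y (½ ℚ.* ε) (½-pos 0<ε)
... | N , hx | M , hy = N ℕ.⊔ M , λ m n N⊔M≤m N⊔M≤n →
  subst₂ ℚ._<_
    (cong ℚ.∣_∣ (sym (+-minus-interchange (seq x m) (seq y m) (seq x n) (seq y n))))
    (½+½ ε)
    (ℚ.≤-<-trans (ℚ.∣p+q∣≤∣p∣+∣q∣ (seq x m ℚ.- seq x n) (seq y m ℚ.- seq y n))
      (ℚ.+-mono-< (hx m n (ℕ.m⊔n≤o⇒m≤o N M N⊔M≤m) (ℕ.m⊔n≤o⇒m≤o N M N⊔M≤n))
                  (hy m n (ℕ.m⊔n≤o⇒n≤o N M N⊔M≤m) (ℕ.m⊔n≤o⇒n≤o N M N⊔M≤n))))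

_⊔ᵣ_ : ℝ → ℝ → ℝ
seq    (x ⊔ᵣ y) n = seq x n ℚ.⊔ seq y n
cauchy (x ⊔ᵣ y) ε 0<ε with cauchy x ε 0<ε | cauchy y ε 0<ε
... | N , hx | M , hy = N ℕ.⊔ M , λ m n N⊔M≤m N⊔M≤n →
  let h₁ = hx m n (ℕ.m⊔n≤o⇒m≤o N M N⊔M≤m) (ℕ.m⊔n≤o⇒m≤o N M N⊔M≤n)
      h₂ = hy m n (ℕ.m⊔n≤o⇒n≤o N M N⊔M≤m) (ℕ.m⊔n≤o⇒n≤o N M N⊔M≤n)
  in ∣-∣<-intro {seq x m ℚ.⊔ seq y m}
       (⊔-minus-< (seq x m) (seq y m) (seq x n) (seq y n)
         (∣-∣<-elimˡ (seq x m) (seq x n) h₁) (∣-∣<-elimˡ (seq y m) (seq y n) h₂))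
       (⊔-minus-< (seq x n) (seq y n) (seq x m) (seq y m)
         (∣-∣<-elimʳ (seq x m) (seq x n) h₁) (∣-∣<-elimʳ (seq y m) (seq y n) h₂))

max : ∀ {k} → .{{_ : NonZero k}} → (Fin k → ℝ) → ℝ
max {suc k} a = foldr _⊔ᵣ_ (head a) (tail a)

SetFunction : ℕ → Set
SetFunction n = Subset n → ℝ

∑[_] : ∀ {n} → Subset n → (Fin n → ℝ) → ℝ
∑[ [] ]          h = 0ᵣ
∑[ inside  ∷ X ] h = h zero +ᵣ ∑[ X ] (h ∘ suc)
∑[ outside ∷ X ] h = ∑[ X ] (h ∘ suc)

Additive : ∀ {n} → SetFunction n → Set
Additive g = ∀ X → g X ≃ᵣ ∑[ X ] (λ v → g ⁅ v ⁆)

XOS : ∀ k → .{{_ : NonZero k}} → ∀ {n} → SetFunction n → Set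
XOS k {n} f = Σ[ fs ∈ (Fin k → SetFunction n) ]
  (∀ i → Additive (fs i)) × (∀ X → f X ≃ᵣ max (λ i → fs i X))

OrderEquivalent : ∀ {n} → SetFunction n → SetFunction n → Set
OrderEquivalent f g = ∀ X Y → (f X ≤ᵣ f Y) ⇔ (g X ≤ᵣ g Y)

OrderDifferent : ∀ {n} → SetFunction n → SetFunction n → Set
OrderDifferent f g = ¬ OrderEquivalent f g

-- There are at most N order-equivalence classes of functions satisfying P.
-- There is no quotient type to count, so this says that a finite family of
-- representatives of pairwise distinct classes has at most N members (in
-- particular, that there are only finitely many classes).
AtMostOrderDifferent : ∀ {n} → ℕ → (SetFunction n → Set) → Set
AtMostOrderDifferent {n} N P =
  ∀ m (f : Fin m → SetFunction n) → (∀ i → P (f i)) →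
  (∀ i j → i ≢ j → OrderDifferent (f i) (f j)) → m ℕ.≤ N

{-# OPTIONS --safe #-}

-- The components f₁, …, f_k of a k-XOS function are the restrictions, to the k
-- blocks of a set of N = k n elements, of one additive function, and the order
-- of the maxima is determined by the order of that additive function.  For each
-- weight vector w record the set of pairs (X, Y) of subsets with w(X) ≤ w(Y).
-- These sets form a set system on 4^N points that shatters no N + 1 of them:
-- N + 1 vectors 1_X − 1_Y in ℚ^N satisfy a linear relation with some coefficient
-- positive, so w(X) ≤ w(Y) cannot fail at the pairs with positive coefficient
-- and hold at all the others.  By Sauer–Shelah there are at most (4^N + 1)^N
-- such sets.  The comparisons of reals are only ¬¬-decidable, which suffices
-- because the resulting bound m ≤ 2 ^ (3 N²) is a decidable statement.

module Submission where

open import Defs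
open import Algebra.Bundles using (module CommutativeRing)
open import Data.Bool.Base using (Bool; true; false; _∧_; _∨_; if_then_else_)
import Data.Bool.Properties as Bool
open import Data.Fin.Base using (Fin; zero; suc; combine; remQuot; finToFun; funToFin; punchIn; _↑ˡ_; _↑ʳ_)
import Data.Fin.Properties as Fin
open import Data.Fin.Subset using (Subset; inside; outside; ⁅_⁆; ⊥)
import Data.Integer.Base as ℤ
open import Data.Nat.Base as ℕ using (ℕ; zero; suc; NonZero; _+_; _*_; _^_)
import Data.Nat.Properties as ℕ
open import Data.Nat.Tactic.RingSolver using (solve-∀)
open import Data.Product.Base using (Σ-syntax; ∃-syntax; _×_; _,_; proj₁; proj₂; swap; uncurry)
open import Data.Rational.Base as ℚ using (ℚ; 0ℚ; 1ℚ; ½)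
import Data.Rational.Properties as ℚ
open import Data.Rational.Solver using (module +-*-Solver)
open import Data.Sum.Base using (_⊎_; inj₁; inj₂)
open import Data.Vec.Base using (Vec; []; _∷_; length; lookup; tabulate; _++_)
open import Data.Vec.Functional as Vector using (Vector; foldr; head; insertAt; tail)
open import Data.Vec.Functional.Properties using (insertAt-lookup; insertAt-punchIn)
open import Data.Vec.Properties using (≡-dec; lookup∘tabulate; tabulate-cong; tabulate∘lookup)
open import Effect.Monad using (RawMonad)
open import Function.Base using (_∘_)
open import Function.Bundles using (Inverse; mk⇔)
open import Relation.Binary.Definitions using (tri<; tri≈; tri>)
open import Relation.Binary.PropositionalEquality
open import Relation.Nullary
open import Relation.Nullary.Decidable using (dec-true; dec-false; decidable-stable; ¬¬-excluded-middle)
open import Relation.Nullary.Negation using (¬¬-Monad)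

open import Algebra.Properties.Semiring.Sum (CommutativeRing.semiring ℚ.+-*-commutativeRing)
  using (sum; sum-cong-≗; sum-remove; sum-replicate-zero; ∑-comm; ∑-distrib-+; *-distribʳ-sum; *-distribˡ-sum)
open +-*-Solver

-- Sauer–Shelah

Family : ℕ → Set
Family M = Vec Bool M → Bool

_∪_ _∩_ : ∀ {M} → Family M → Family M → Family M
(F ∪ G) a = F a ∨ G a
(F ∩ G) a = F a ∧ G a

count : ∀ {M} → Family M → ℕ
count {zero}  F = if F [] then 1 else 0
count {suc M} F = count (F ∘ (false ∷_)) + count (F ∘ (true ∷_))

count-∅ : ∀ {M} (F : Family M) → (∀ a → F a ≢ true) → count F ≡ 0
count-∅ {zero} F empty with F [] in eq
... | true  = contradiction eq (empty [])
... | false = refl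
count-∅ {suc M} F empty =
  cong₂ _+_ (count-∅ (F ∘ (false ∷_)) (empty ∘ (false ∷_))) (count-∅ (F ∘ (true ∷_)) (empty ∘ (true ∷_)))

count-∪∩ : ∀ {M} (F G : Family M) → count (F ∪ G) + count (F ∩ G) ≡ count F + count G
count-∪∩ {zero} F G with F [] | G []
... | true  | true  = refl
... | true  | false = refl
... | false | true  = refl
... | false | false = refl
count-∪∩ {suc M} F G = begin
  (count (F₀ ∪ G₀) + count (F₁ ∪ G₁)) + (count (F₀ ∩ G₀) + count (F₁ ∩ G₁))
    ≡⟨ interchange (count (F₀ ∪ G₀)) _ _ _ ⟩
  (count (F₀ ∪ G₀) + count (F₀ ∩ G₀)) + (count (F₁ ∪ G₁) + count (F₁ ∩ G₁))
    ≡⟨ cong₂ _+_ (count-∪∩ F₀ G₀) (count-∪∩ F₁ G₁) ⟩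
  (count F₀ + count G₀) + (count F₁ + count G₁)
    ≡⟨ interchange (count F₀) _ _ _ ⟩
  (count F₀ + count F₁) + (count G₀ + count G₁) ∎
  where
  open ≡-Reasoning
  F₀ = F ∘ (false ∷_) ; F₁ = F ∘ (true ∷_)
  G₀ = G ∘ (false ∷_) ; G₁ = G ∘ (true ∷_)
  interchange : ∀ a b c d → (a + b) + (c + d) ≡ (a + c) + (b + d)
  interchange = solve-∀

count-⁅⁆ : ∀ {M} (a : Vec Bool M) → count (λ b → does (≡-dec Bool._≟_ a b)) ≡ 1
count-⁅⁆ []          = refl
count-⁅⁆ (false ∷ a) = cong₂ _+_ (count-⁅⁆ a) (count-∅ {length a} (λ _ → false) λ _ ())
count-⁅⁆ (true  ∷ a) = cong₂ _+_ (count-∅ {length a} (λ _ → false) λ _ ()) (count-⁅⁆ a)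

image : ∀ {M m} → (Fin m → Vec Bool M) → Family M
image {m = zero}  p a = false
image {m = suc m} p a = does (≡-dec Bool._≟_ (p zero) a) ∨ image (p ∘ suc) a

image⁻ : ∀ {M m} (p : Fin m → Vec Bool M) {a} → image p a ≡ true → ∃[ r ] p r ≡ a
image⁻ {m = suc m} p {a} h with ≡-dec Bool._≟_ (p zero) a
... | yes p₀≡a = zero , p₀≡a
... | no  _    with r , eq ← image⁻ (p ∘ suc) h = suc r , eq

-- Induction on `m`: injectivity makes the singleton of `p zero` disjoint from the image of the
-- rest, so the intersection term of `count-∪∩` is 0.
count-image : ∀ {M m} (p : Fin m → Vec Bool M) → (∀ r r′ → p r ≡ p r′ → r ≡ r′) → count (image p) ≡ m
count-image {m = zero}  p inj = count-∅ (image p) λ _ ()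
count-image {m = suc m} p inj = begin
  count (P₀ ∪ Pₛ)                    ≡⟨ ℕ.+-identityʳ _ ⟨
  count (P₀ ∪ Pₛ) + 0                ≡⟨ cong (count (P₀ ∪ Pₛ) +_) (count-∅ (P₀ ∩ Pₛ) disjoint) ⟨
  count (P₀ ∪ Pₛ) + count (P₀ ∩ Pₛ)  ≡⟨ count-∪∩ P₀ Pₛ ⟩
  count P₀ + count Pₛ                ≡⟨ cong₂ _+_ (count-⁅⁆ (p zero)) (count-image (p ∘ suc) λ r r′ → Fin.suc-injective ∘ inj _ _) ⟩
  suc m                              ∎
  where
  open ≡-Reasoning
  P₀ = λ a → does (≡-dec Bool._≟_ (p zero) a)
  Pₛ = image (p ∘ suc)
  disjoint : ∀ a → (P₀ ∩ Pₛ) a ≢ true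
  disjoint a h with ≡-dec Bool._≟_ (p zero) a
  ... | yes p₀≡a with r , pᵣ≡a ← image⁻ (p ∘ suc) h with () ← inj _ _ (trans p₀≡a (sym pᵣ≡a))

-- A sequence of coordinates stands for a set: a shattered sequence has no repetitions, because some
-- `b` takes different values at two given positions.
Shatters : ∀ {M t} → Family M → (Fin t → Fin M) → Set
Shatters {M} {t} F s = ∀ (b : Fin t → Bool) → ∃[ a ] (F a ≡ true × (∀ j → lookup a (s j) ≡ b j))

-- The union of the two halves is the projection of `F` that forgets the first coordinate, so each
-- witness extends by at least one first bit to a member of `F`.
shatters-∪ : ∀ {M t} (F : Family (suc M)) {s : Fin t → Fin M} →
  Shatters ((F ∘ (false ∷_)) ∪ (F ∘ (true ∷_))) s → Shatters F (suc ∘ s)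
shatters-∪ F sh b with sh b
... | a , Fa , eq with F (false ∷ a) in F₀
... | true  = false ∷ a , F₀ , eq
... | false = true ∷ a , Fa , eq

-- A vector in both halves extends by either first bit, so the first coordinate can be prescribed as
-- well; the shattered sequence grows by one.
shatters-∩ : ∀ {M t} (F : Family (suc M)) {s : Fin t → Fin M} →
  Shatters ((F ∘ (false ∷_)) ∩ (F ∘ (true ∷_))) s → Shatters F (zero Vector.∷ (suc ∘ s))
shatters-∩ F sh b with sh (b ∘ suc)
... | a , Fa , eq with F (false ∷ a) in F₀ | F (true ∷ a) in F₁ | b zero in b₀
... | true | true | false = false ∷ a , F₀ , λ { zero → sym b₀ ; (suc j) → eq j }
... | true | true | true  = true  ∷ a , F₁ , λ { zero → sym b₀ ; (suc j) → eq j }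

-- The sum of the binomial coefficients C(M, i) over i < t, given by Pascal's rule.
sauerBound : ℕ → ℕ → ℕ
sauerBound M       zero    = 0
sauerBound zero    (suc t) = 1
sauerBound (suc M) (suc t) = sauerBound M (suc t) + sauerBound M t

-- Induction on `M`: the two halves have together as many members as their union and intersection.
-- If `F` shatters no `suc t` coordinates, then neither does the union, and the intersection
-- shatters no `t`.
sauer-shelah : ∀ {M} t (F : Family M) → (∀ (s : Fin t → Fin M) → ¬ Shatters F s) → count F ℕ.≤ sauerBound M t
-- Any member of `F` shatters the empty sequence, so here `F` is empty.
sauer-shelah zero F h = ℕ.≤-reflexive (count-∅ F λ a Fa → h (λ ()) λ b → a , Fa , λ ())
sauer-shelah {zero} (suc t) F h with F []
... | true  = ℕ.≤-refl
... | false = ℕ.z≤n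
sauer-shelah {suc M} (suc t) F h = begin
  count F₀ + count F₁                ≡⟨ count-∪∩ F₀ F₁ ⟨
  count (F₀ ∪ F₁) + count (F₀ ∩ F₁)  ≤⟨ ℕ.+-mono-≤
    (sauer-shelah (suc t) (F₀ ∪ F₁) λ s → h (suc ∘ s) ∘ shatters-∪ F)
    (sauer-shelah t (F₀ ∩ F₁) λ s → h (zero Vector.∷ (suc ∘ s)) ∘ shatters-∩ F) ⟩
  sauerBound M (suc t) + sauerBound M t ∎
  where
  open ℕ.≤-Reasoning
  F₀ = F ∘ (false ∷_) ; F₁ = F ∘ (true ∷_)

sauerBound≤ : ∀ M t → sauerBound M (suc t) ℕ.≤ suc M ^ t
sauerBound≤ zero    t       = ℕ.m^n>0 1 t
sauerBound≤ (suc M) zero    = ℕ.≤-trans (ℕ.≤-reflexive (ℕ.+-identityʳ _)) (sauerBound≤ M zero)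
sauerBound≤ (suc M) (suc t) = begin
  sauerBound M (suc (suc t)) + sauerBound M (suc t) ≤⟨ ℕ.+-mono-≤ (sauerBound≤ M (suc t)) (sauerBound≤ M t) ⟩
  -- In the swapped order the sum is the product `suc (suc M) * suc M ^ t` by definition.
  suc M * suc M ^ t + suc M ^ t                     ≡⟨ ℕ.+-comm (suc M * suc M ^ t) _ ⟩
  suc (suc M) * suc M ^ t                           ≤⟨ ℕ.*-monoʳ-≤ (suc (suc M)) (ℕ.^-monoˡ-≤ t (ℕ.n≤1+n (suc M))) ⟩
  suc (suc M) * suc (suc M) ^ t                     ∎
  where open ℕ.≤-Reasoning

patterns-bound : ∀ {M m} d (p : Fin m → Vec Bool M) → (∀ r r′ → p r ≡ p r′ → r ≡ r′) →
  (∀ (s : Fin (suc d) → Fin M) → ¬ (∀ b → ∃[ r ] (∀ j → lookup (p r) (s j) ≡ b j))) →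
  m ℕ.≤ suc M ^ d
patterns-bound {M} {m} d p inj h = begin
  m                    ≡⟨ count-image p inj ⟨
  count (image p)      ≤⟨ sauer-shelah (suc d) (image p) (λ s sh → h s λ b →
    let a , Fa , eq = sh b
        r , pᵣ≡a    = image⁻ p Fa
    in r , λ j → trans (cong (λ v → lookup v (s j)) pᵣ≡a) (eq j)) ⟩
  sauerBound M (suc d) ≤⟨ sauerBound≤ M d ⟩
  suc M ^ d            ∎
  where open ℕ.≤-Reasoning

-- For N ≥ 1 the base satisfies 1 + 4^N ≤ 2 · 4^N ≤ 8^N. This fails for N = 0, where both sides of
-- the claim are 1.
subset-pairs-bound : ∀ N → suc (2 ^ N * 2 ^ N) ^ N ℕ.≤ 2 ^ (3 * (N * N))
subset-pairs-bound zero      = ℕ.≤-refl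
subset-pairs-bound N@(suc _) = begin
  suc (2 ^ N * 2 ^ N) ^ N       ≤⟨ ℕ.^-monoˡ-≤ N (begin
    suc (2 ^ N * 2 ^ N)            ≤⟨ ℕ.+-monoˡ-≤ (2 ^ N * 2 ^ N) (ℕ.m^n>0 2 N) ⟩
    2 ^ N + 2 ^ N * 2 ^ N          ≤⟨ ℕ.+-monoˡ-≤ (2 ^ N * 2 ^ N) (ℕ.m≤m*n (2 ^ N) (2 ^ N) ⦃ ℕ.m^n≢0 2 N ⦄) ⟩
    2 ^ N * 2 ^ N + 2 ^ N * 2 ^ N  ≡⟨ double (2 ^ N * 2 ^ N) ⟩
    2 * (2 ^ N * 2 ^ N)            ≤⟨ ℕ.*-monoˡ-≤ (2 ^ N * 2 ^ N) (ℕ.^-monoʳ-≤ 2 {1} {N} (ℕ.s≤s ℕ.z≤n)) ⟩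
    2 ^ N * (2 ^ N * 2 ^ N)        ≡⟨ cong (2 ^ N *_) (ℕ.^-distribˡ-+-* 2 N N) ⟨
    2 ^ N * 2 ^ (N + N)            ≡⟨ ℕ.^-distribˡ-+-* 2 N (N + N) ⟨
    2 ^ (N + (N + N))              ≡⟨ cong (2 ^_) (triple N) ⟩
    2 ^ (3 * N)                    ∎) ⟩
  (2 ^ (3 * N)) ^ N             ≡⟨ ℕ.^-*-assoc 2 (3 * N) N ⟩
  2 ^ (3 * N * N)               ≡⟨ cong (2 ^_) (ℕ.*-assoc 3 N N) ⟩
  2 ^ (3 * (N * N))             ∎
  where
  open ℕ.≤-Reasoning
  double : ∀ a → a + a ≡ 2 * a
  double = solve-∀
  triple : ∀ a → a + (a + a) ≡ 3 * a
  triple = solve-∀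

-- Linear relations over ℚ

-- A zero vector has every index as a pivot, with all ratios 0; this spares the
-- elimination below a case distinction.
pivot : ∀ {N} (a : Vector ℚ (suc N)) → ∃[ i ] Σ[ r ∈ Vector ℚ N ] (∀ t → a (punchIn i t) ≡ r t ℚ.* a i)
pivot {N} a with Fin.any? (λ i → ¬? (a i ℚ.≟ 0ℚ))
... | yes (i , aᵢ≢0) = i , r , λ t → sym (begin
  a (punchIn i t) ℚ.* ℚ.1/ a i ℚ.* a i    ≡⟨ ℚ.*-assoc (a (punchIn i t)) _ _ ⟩
  a (punchIn i t) ℚ.* (ℚ.1/ a i ℚ.* a i)  ≡⟨ cong (a (punchIn i t) ℚ.*_) (ℚ.*-inverseˡ (a i)) ⟩
  a (punchIn i t) ℚ.* 1ℚ                  ≡⟨ ℚ.*-identityʳ _ ⟩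
  a (punchIn i t)                         ∎)
  where
  open ≡-Reasoning
  instance aᵢ-nonZero = ℚ.≢-nonZero aᵢ≢0
  r : Vector ℚ N
  r t = a (punchIn i t) ℚ.* ℚ.1/ a i
... | no all≡0 = zero , (λ _ → 0ℚ) , λ t →
  trans (decidable-stable (a (suc t) ℚ.≟ 0ℚ) λ ≢0 → all≡0 (suc t , ≢0)) (sym (ℚ.*-zeroˡ (a zero)))

-- Gaussian elimination: multiples of the pivot row `i` clear column zero of the other rows, and
-- induction gives a relation `c′` between the remaining columns of the cleared rows.
dependent : ∀ {N} (A : Vector (Vector ℚ N) (suc N)) →
  Σ[ c ∈ Vector ℚ (suc N) ] (∃[ t ] c t ≢ 0ℚ) × (∀ z → sum (λ t → c t ℚ.* A t z) ≡ 0ℚ)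
dependent {zero}  A = (λ _ → 1ℚ) , (zero , λ ()) , λ ()
dependent {suc N} A with pivot (λ t → A t zero)
... | i , r , a≡ra with dependent {N} (λ t z → A (punchIn i t) (suc z) ℚ.- r t ℚ.* A i (suc z))
... | c′ , (t , c′ₜ≢0) , sum≡0 =
  c , (punchIn i t , c′ₜ≢0 ∘ trans (sym (insertAt-punchIn c′ i v t))) , λ z → begin
    sum (λ t → c t ℚ.* A t z)
      ≡⟨ sum-remove {i = i} (λ t → c t ℚ.* A t z) ⟩
    c i ℚ.* A i z ℚ.+ sum (λ t → c (punchIn i t) ℚ.* A (punchIn i t) z)
      ≡⟨ cong₂ ℚ._+_ (cong (ℚ._* A i z) (insertAt-lookup c′ i v))
           (sum-cong-≗ λ t → cong (ℚ._* A (punchIn i t) z) (insertAt-punchIn c′ i v t)) ⟩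
    v ℚ.* A i z ℚ.+ sum (λ t → c′ t ℚ.* A (punchIn i t) z)
      ≡⟨ cong (ℚ._+ sum (λ t → c′ t ℚ.* A (punchIn i t) z)) (*-distribʳ-sum (A i z) (λ t → ℚ.- (c′ t ℚ.* r t))) ⟩
    sum (λ t → ℚ.- (c′ t ℚ.* r t) ℚ.* A i z) ℚ.+ sum (λ t → c′ t ℚ.* A (punchIn i t) z)
      ≡⟨ ∑-distrib-+ (λ t → ℚ.- (c′ t ℚ.* r t) ℚ.* A i z) (λ t → c′ t ℚ.* A (punchIn i t) z) ⟨
    sum (λ t → ℚ.- (c′ t ℚ.* r t) ℚ.* A i z ℚ.+ c′ t ℚ.* A (punchIn i t) z)
      ≡⟨ sum-cong-≗ (λ t → collect (c′ t) (r t) (A i z) (A (punchIn i t) z)) ⟩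
    sum (λ t → c′ t ℚ.* (A (punchIn i t) z ℚ.- r t ℚ.* A i z))
      ≡⟨ reduced z ⟩
    0ℚ ∎
  where
  open ≡-Reasoning
  v : ℚ
  -- The coefficient of the pivot row gathers the multiples of it that were subtracted from the
  -- other rows.
  v = sum (λ t → ℚ.- (c′ t ℚ.* r t))
  c : Vector ℚ _
  c = insertAt c′ i v
  collect : ∀ c r a b → ℚ.- (c ℚ.* r) ℚ.* a ℚ.+ c ℚ.* b ≡ c ℚ.* (b ℚ.- r ℚ.* a)
  collect = solve 4 (λ c r a b → :- (c :* r) :* a :+ c :* b := c :* (b :- r :* a)) refl
  reduced : ∀ z → sum (λ t → c′ t ℚ.* (A (punchIn i t) z ℚ.- r t ℚ.* A i z)) ≡ 0ℚ
  reduced (suc z) = sum≡0 z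
  reduced zero    = trans (sum-cong-≗ λ t →
    trans (cong (c′ t ℚ.*_) (trans (cong (ℚ._- r t ℚ.* A i zero) (a≡ra t)) (ℚ.+-inverseʳ (r t ℚ.* A i zero))))
          (ℚ.*-zeroʳ (c′ t)))
    (sum-replicate-zero (suc N))

dependent⁺ : ∀ {N} (A : Vector (Vector ℚ N) (suc N)) →
  Σ[ c ∈ Vector ℚ (suc N) ] (∃[ t ] 0ℚ ℚ.< c t) × (∀ z → sum (λ t → c t ℚ.* A t z) ≡ 0ℚ)
dependent⁺ A with dependent A
... | c , (t , cₜ≢0) , sum≡0 with ℚ.<-cmp 0ℚ (c t)
... | tri< 0<cₜ _ _ = c , (t , 0<cₜ) , sum≡0
... | tri≈ _ 0≡cₜ _ = contradiction (sym 0≡cₜ) cₜ≢0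
... | tri> _ _ cₜ<0 = ℚ.-_ ∘ c , (t , ℚ.neg-antimono-< cₜ<0) , λ z → begin
  sum (λ t → ℚ.- c t ℚ.* A t z)              ≡⟨ sum-cong-≗ (λ t → neg (c t) (A t z)) ⟩
  sum (λ t → ℚ.- 1ℚ ℚ.* (c t ℚ.* A t z))     ≡⟨ *-distribˡ-sum (ℚ.- 1ℚ) (λ t → c t ℚ.* A t z) ⟨
  ℚ.- 1ℚ ℚ.* sum (λ t → c t ℚ.* A t z)       ≡⟨ cong (ℚ.- 1ℚ ℚ.*_) (sum≡0 z) ⟩
  0ℚ                                         ∎
  where
  open ≡-Reasoning
  neg : ∀ p q → ℚ.- p ℚ.* q ≡ ℚ.- 1ℚ ℚ.* (p ℚ.* q)
  neg = solve 2 (λ p q → :- p :* q := con (ℚ.- 1ℚ) :* (p :* q)) refl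

-- Order of the reals

Eventually : (ℕ → Set) → Set
Eventually P = ∃[ N ] (∀ n → N ℕ.≤ n → P n)

eventually-map₂ : ∀ {P Q R : ℕ → Set} → (∀ n → P n → Q n → R n) → Eventually P → Eventually Q → Eventually R
eventually-map₂ f (N , p) (M , q) = N ℕ.⊔ M , λ n N⊔M≤n →
  f n (p n (ℕ.m⊔n≤o⇒m≤o N M N⊔M≤n)) (q n (ℕ.m⊔n≤o⇒n≤o N M N⊔M≤n))

eventually-map : ∀ {P Q : ℕ → Set} → (∀ n → P n → Q n) → Eventually P → Eventually Q
eventually-map f (N , p) = N , λ n → f n ∘ p n

-- An inequality depends only on the difference of its sides. Every later estimate thereby splits
-- into monotonicity and one ring identity.
≤-shift : ∀ {p q p′ q′} → q′ ℚ.- p′ ≡ q ℚ.- p → p ℚ.≤ q → p′ ℚ.≤ q′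
≤-shift {p} {q} {p′} {q′} eq p≤q = subst₂ ℚ._≤_ (cancelˡ p p′)
  (trans (rotate p q p′) (trans (cong (ℚ._+ p′) (sym eq)) (cancelʳ p′ q′)))
  (ℚ.+-monoˡ-≤ (p′ ℚ.- p) p≤q)
  where
  cancelˡ : ∀ p p′ → p ℚ.+ (p′ ℚ.- p) ≡ p′
  cancelˡ = solve 2 (λ p p′ → p :+ (p′ :- p) := p′) refl
  cancelʳ : ∀ p′ q′ → (q′ ℚ.- p′) ℚ.+ p′ ≡ q′
  cancelʳ = solve 2 (λ p′ q′ → (q′ :- p′) :+ p′ := q′) refl
  rotate : ∀ p q p′ → q ℚ.+ (p′ ℚ.- p) ≡ (q ℚ.- p) ℚ.+ p′
  rotate = solve 3 (λ p q p′ → q :+ (p′ :- p) := (q :- p) :+ p′) refl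

abstract -- unfolding these rationals in later conversion checks is prohibitively expensive
  half : ∀ {ε} → 0ℚ ℚ.< ε → ∃[ η ] (0ℚ ℚ.< η × ε ≡ η ℚ.+ η)
  half {ε} 0<ε = ½ ℚ.* ε , ℚ.*-monoʳ-<-pos ½ 0<ε , split ε
    where
    split : ∀ ε → ε ≡ ½ ℚ.* ε ℚ.+ ½ ℚ.* ε
    split = solve 1 (λ ε → ε := con ½ :* ε :+ con ½ :* ε) refl

  fifth : ∀ {ε} → 0ℚ ℚ.< ε → ∃[ η ] (0ℚ ℚ.< η × ε ≡ η ℚ.+ η ℚ.+ η ℚ.+ η ℚ.+ η)
  fifth {ε} 0<ε = ℤ.+ 1 ℚ./ 5 ℚ.* ε , ℚ.*-monoʳ-<-pos (ℤ.+ 1 ℚ./ 5) 0<ε , split ε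
    where
    split : ∀ ε → let η = ℤ.+ 1 ℚ./ 5 ℚ.* ε in ε ≡ η ℚ.+ η ℚ.+ η ℚ.+ η ℚ.+ η
    split = solve 1 (λ ε → let η = con (ℤ.+ 1 ℚ./ 5) :* ε in ε := η :+ η :+ η :+ η :+ η) refl

p≤p+ε : ∀ p {ε} → 0ℚ ℚ.< ε → p ℚ.≤ p ℚ.+ ε
p≤p+ε p 0<ε = ℚ.≤-trans (ℚ.≤-reflexive (sym (ℚ.+-identityʳ p))) (ℚ.+-monoʳ-≤ p (ℚ.<⇒≤ 0<ε))

p≤∣p∣ : ∀ p → p ℚ.≤ ℚ.∣ p ∣
p≤∣p∣ p with ℚ.≤-total 0ℚ p
... | inj₁ 0≤p = ℚ.≤-reflexive (sym (ℚ.0≤p⇒∣p∣≡p 0≤p))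
... | inj₂ p≤0 = ℚ.≤-trans p≤0 (ℚ.0≤∣p∣ p)

near : ∀ (x : ℝ) {ε} → 0ℚ ℚ.< ε → ∃[ N ] (∀ m n → N ℕ.≤ m → N ℕ.≤ n → seq x m ℚ.- seq x n ℚ.≤ ε)
near x 0<ε with cauchy x _ 0<ε
... | N , h = N , λ m n N≤m N≤n → ℚ.≤-trans (p≤∣p∣ _) (ℚ.<⇒≤ (h m n N≤m N≤n))

infix 4 _<ᵣ_

-- Strictness carries an explicit gap `δ`, which the negation of `_≤ᵣ_` does not supply
-- constructively.
_<ᵣ_ : ℝ → ℝ → Set
x <ᵣ y = ∃[ δ ] (0ℚ ℚ.< δ × Eventually (λ n → seq x n ℚ.+ δ ℚ.≤ seq y n))

private
  perturb-≤ : ∀ p q a b η → p ℚ.- a ℚ.≤ η → b ℚ.- q ℚ.≤ η → a ℚ.≤ b ℚ.+ (η ℚ.+ η ℚ.+ η) →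
    p ℚ.≤ q ℚ.+ (η ℚ.+ η ℚ.+ η ℚ.+ η ℚ.+ η)
  perturb-≤ p q a b η h₁ h₂ h₃ = ≤-shift (identity p q a b η) (ℚ.+-mono-≤ (ℚ.+-mono-≤ h₁ h₂) h₃)
    where
    identity : ∀ p q a b η → (q ℚ.+ (η ℚ.+ η ℚ.+ η ℚ.+ η ℚ.+ η)) ℚ.- p ≡
      (η ℚ.+ η ℚ.+ (b ℚ.+ (η ℚ.+ η ℚ.+ η))) ℚ.- ((p ℚ.- a) ℚ.+ (b ℚ.- q) ℚ.+ a)
    identity = solve 5 (λ p q a b η → (q :+ (η :+ η :+ η :+ η :+ η)) :- p :=
      (η :+ η :+ (b :+ (η :+ η :+ η))) :- ((p :- a) :+ (b :- q) :+ a)) refl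

  perturb-> : ∀ p q a b η → a ℚ.- p ℚ.≤ η → q ℚ.- b ℚ.≤ η → b ℚ.+ (η ℚ.+ η ℚ.+ η) ℚ.≤ a → q ℚ.+ η ℚ.≤ p
  perturb-> p q a b η h₁ h₂ h₃ = ≤-shift (identity p q a b η) (ℚ.+-mono-≤ (ℚ.+-mono-≤ h₁ h₂) h₃)
    where
    identity : ∀ p q a b η → p ℚ.- (q ℚ.+ η) ≡
      (η ℚ.+ η ℚ.+ a) ℚ.- ((a ℚ.- p) ℚ.+ (q ℚ.- b) ℚ.+ (b ℚ.+ (η ℚ.+ η ℚ.+ η)))
    identity = solve 5 (λ p q a b η → p :- (q :+ η) :=
      (η :+ η :+ a) :- ((a :- p) :+ (q :- b) :+ (b :+ (η :+ η :+ η)))) refl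

-- The order of reals is undecidable, but a tolerance makes one rational test enough. With ε = 5η,
-- both sequences stay within η of their values `a`, `b` at index `K`. If a ≤ b + 3η, then x ≤ y +
-- 5η from there on; otherwise y + η ≤ x.
<ᵣ-dichotomy : ∀ x y {ε} → 0ℚ ℚ.< ε → y <ᵣ x ⊎ Eventually (λ n → seq x n ℚ.≤ seq y n ℚ.+ ε)
<ᵣ-dichotomy x y {ε} 0<ε = decide (a ℚ.≤? b ℚ.+ (η ℚ.+ η ℚ.+ η))
  where
  η = proj₁ (fifth 0<ε)
  0<η = proj₁ (proj₂ (fifth 0<ε))
  ε≡5η = proj₂ (proj₂ (fifth 0<ε))
  N = proj₁ (near x 0<η)
  M = proj₁ (near y 0<η)
  K = N ℕ.⊔ M
  a = seq x K
  b = seq y K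
  decide : Dec (a ℚ.≤ b ℚ.+ (η ℚ.+ η ℚ.+ η)) →
    y <ᵣ x ⊎ Eventually (λ n → seq x n ℚ.≤ seq y n ℚ.+ ε)
  decide (yes a≤b+3η) = inj₂ (K , λ n K≤n → subst (λ ε → seq x n ℚ.≤ seq y n ℚ.+ ε) (sym ε≡5η)
    (perturb-≤ (seq x n) (seq y n) a b η
      (proj₂ (near x 0<η) n K (ℕ.m⊔n≤o⇒m≤o N M K≤n) (ℕ.m≤m⊔n N M))
      (proj₂ (near y 0<η) K n (ℕ.m≤n⊔m N M) (ℕ.m⊔n≤o⇒n≤o N M K≤n))
      a≤b+3η))
  decide (no a≰b+3η) = inj₁ (η , 0<η , K , λ n K≤n → perturb-> (seq x n) (seq y n) a b η
    (proj₂ (near x 0<η) K n (ℕ.m≤m⊔n N M) (ℕ.m⊔n≤o⇒m≤o N M K≤n))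
    (proj₂ (near y 0<η) n K (ℕ.m⊔n≤o⇒n≤o N M K≤n) (ℕ.m≤n⊔m N M))
    (ℚ.<⇒≤ (ℚ.≰⇒> a≰b+3η)))

≮ᵣ⇒≥ᵣ : ∀ x y → ¬ y <ᵣ x → x ≤ᵣ y
≮ᵣ⇒≥ᵣ x y y≮x ε 0<ε with <ᵣ-dichotomy x y 0<ε
... | inj₁ y<x = contradiction y<x y≮x
... | inj₂ h   = h

<ᵣ⇒≱ᵣ : ∀ x y → y <ᵣ x → ¬ x ≤ᵣ y
<ᵣ⇒≱ᵣ x y (δ , 0<δ , gap) x≤y with half 0<δ
... | η , 0<η , refl with eventually-map₂ (λ n → ℚ.≤-trans) gap (x≤y η 0<η)
... | N , h = ℚ.<-irrefl refl (ℚ.<-≤-trans 0<η (≤-shift (identity (seq y N) η) (h N ℕ.≤-refl)))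
  where
  identity : ∀ q η → 0ℚ ℚ.- η ≡ (q ℚ.+ η) ℚ.- (q ℚ.+ (η ℚ.+ η))
  identity = solve 2 (λ q η → con 0ℚ :- η := (q :+ η) :- (q :+ (η :+ η))) refl

-- `x ≤ᵣ y` is equivalent to the negation of `y <ᵣ x`, and negations are stable. Comparisons may
-- thus be proved by contradiction.
≤ᵣ-stable : ∀ x y → ¬ ¬ x ≤ᵣ y → x ≤ᵣ y
≤ᵣ-stable x y ¬¬x≤y = ≮ᵣ⇒≥ᵣ x y (¬¬x≤y ∘ <ᵣ⇒≱ᵣ x y)

<ᵣ⇒≤ᵣ : ∀ x y → x <ᵣ y → x ≤ᵣ y
<ᵣ⇒≤ᵣ x y (δ , 0<δ , gap) ε 0<ε = eventually-map
  (λ n x+δ≤y → ℚ.≤-trans (p≤p+ε (seq x n) 0<δ) (ℚ.≤-trans x+δ≤y (p≤p+ε (seq y n) 0<ε))) gap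

≰ᵣ⇒≥ᵣ : ∀ x y → ¬ x ≤ᵣ y → y ≤ᵣ x
≰ᵣ⇒≥ᵣ x y x≰y = ≮ᵣ⇒≥ᵣ y x (x≰y ∘ <ᵣ⇒≤ᵣ x y)

≤ᵣ-trans : ∀ x y z → x ≤ᵣ y → y ≤ᵣ z → x ≤ᵣ z
≤ᵣ-trans x y z x≤y y≤z ε 0<ε with half 0<ε
... | η , 0<η , refl = eventually-map₂
  (λ n p q → ≤-shift (identity (seq x n) (seq y n) (seq z n) η) (ℚ.+-mono-≤ p q))
  (x≤y η 0<η) (y≤z η 0<η)
  where
  identity : ∀ x y z η → (z ℚ.+ (η ℚ.+ η)) ℚ.- x ≡ ((y ℚ.+ η) ℚ.+ (z ℚ.+ η)) ℚ.- (x ℚ.+ y)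
  identity = solve 4 (λ x y z η → (z :+ (η :+ η)) :- x := ((y :+ η) :+ (z :+ η)) :- (x :+ y)) refl

pointwise⇒≤ᵣ : ∀ x y → (∀ n → seq x n ℚ.≤ seq y n) → x ≤ᵣ y
pointwise⇒≤ᵣ x y h ε 0<ε = 0 , λ n _ → ℚ.≤-trans (h n) (p≤p+ε (seq y n) 0<ε)

-- Maxima of reals

⊔ᵣ-lub : ∀ x y z → x ≤ᵣ z → y ≤ᵣ z → x ⊔ᵣ y ≤ᵣ z
⊔ᵣ-lub x y z x≤z y≤z ε 0<ε = eventually-map₂ (λ n → ℚ.⊔-lub) (x≤z ε 0<ε) (y≤z ε 0<ε)

⊔ᵣ-lub-< : ∀ x y z → x <ᵣ z → y <ᵣ z → x ⊔ᵣ y <ᵣ z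
⊔ᵣ-lub-< x y z (δ , 0<δ , x+δ≤z) (δ′ , 0<δ′ , y+δ′≤z) = δ ℚ.⊓ δ′ , 0<⊓ , eventually-map₂ lub x+δ≤z y+δ′≤z
  where
  0<⊓ : 0ℚ ℚ.< δ ℚ.⊓ δ′
  0<⊓ with ℚ.⊓-sel δ δ′
  ... | inj₁ eq = subst (0ℚ ℚ.<_) (sym eq) 0<δ
  ... | inj₂ eq = subst (0ℚ ℚ.<_) (sym eq) 0<δ′
  lub : ∀ n → seq x n ℚ.+ δ ℚ.≤ seq z n → seq y n ℚ.+ δ′ ℚ.≤ seq z n →
    (seq x n ℚ.⊔ seq y n) ℚ.+ (δ ℚ.⊓ δ′) ℚ.≤ seq z n
  lub n p q with ℚ.⊔-sel (seq x n) (seq y n)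
  ... | inj₁ eq rewrite eq = ℚ.≤-trans (ℚ.+-monoʳ-≤ (seq x n) (ℚ.p⊓q≤p δ δ′)) p
  ... | inj₂ eq rewrite eq = ℚ.≤-trans (ℚ.+-monoʳ-≤ (seq y n) (ℚ.p⊓q≤q δ δ′)) q

-- Deciding which argument attains the maximum is avoided: strict bounds `x <ᵣ a` and `y <ᵣ a` would
-- give `x ⊔ᵣ y <ᵣ a`, and stating the result negatively lets both be assumed.
≰ᵣ-⊔ᵣ : ∀ a x y → ¬ a ≤ᵣ x → ¬ a ≤ᵣ y → ¬ a ≤ᵣ x ⊔ᵣ y
≰ᵣ-⊔ᵣ a x y a≰x a≰y a≤x⊔y =
  a≰x (≮ᵣ⇒≥ᵣ a x λ x<a → a≰y (≮ᵣ⇒≥ᵣ a y λ y<a → <ᵣ⇒≱ᵣ a (x ⊔ᵣ y) (⊔ᵣ-lub-< x y a x<a y<a) a≤x⊔y))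

x≤x⊔y : ∀ x y → x ≤ᵣ x ⊔ᵣ y
x≤x⊔y x y = pointwise⇒≤ᵣ x (x ⊔ᵣ y) λ n → ℚ.p≤p⊔q (seq x n) (seq y n)

y≤x⊔y : ∀ x y → y ≤ᵣ x ⊔ᵣ y
y≤x⊔y x y = pointwise⇒≤ᵣ y (x ⊔ᵣ y) λ n → ℚ.p≤q⊔p (seq x n) (seq y n)

private
  -- `max` starts its fold at the head of the vector; induction on the tail needs an arbitrary
  -- starting value `e`.
  foldr-⊔ : ∀ {k} → ℝ → Vector ℝ k → ℝ
  foldr-⊔ e b = foldr _⊔ᵣ_ e b

  base≤foldr : ∀ {k} e (b : Vector ℝ k) → e ≤ᵣ foldr-⊔ e b
  base≤foldr {zero}  e b = pointwise⇒≤ᵣ e e λ n → ℚ.≤-refl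
  base≤foldr {suc k} e b =
    ≤ᵣ-trans e (foldr-⊔ e (tail b)) (foldr-⊔ e b) (base≤foldr e (tail b)) (y≤x⊔y (head b) (foldr-⊔ e (tail b)))

  ≤foldr : ∀ {k} e (b : Vector ℝ k) i → b i ≤ᵣ foldr-⊔ e b
  ≤foldr e b zero    = x≤x⊔y (head b) (foldr-⊔ e (tail b))
  ≤foldr e b (suc i) =
    ≤ᵣ-trans (b (suc i)) (foldr-⊔ e (tail b)) (foldr-⊔ e b) (≤foldr e (tail b) i) (y≤x⊔y (head b) (foldr-⊔ e (tail b)))

  foldr-lub : ∀ {k} e (b : Vector ℝ k) z → e ≤ᵣ z → (∀ i → b i ≤ᵣ z) → foldr-⊔ e b ≤ᵣ z
  foldr-lub {zero}  e b z e≤z b≤z = e≤z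
  foldr-lub {suc k} e b z e≤z b≤z =
    ⊔ᵣ-lub (head b) (foldr-⊔ e (tail b)) z (b≤z zero) (foldr-lub e (tail b) z e≤z (b≤z ∘ suc))

  ≰-foldr : ∀ {k} e (b : Vector ℝ k) z → ¬ z ≤ᵣ e → (∀ i → ¬ z ≤ᵣ b i) → ¬ z ≤ᵣ foldr-⊔ e b
  ≰-foldr {zero}  e b z z≰e z≰b = z≰e
  ≰-foldr {suc k} e b z z≰e z≰b =
    ≰ᵣ-⊔ᵣ z (head b) (foldr-⊔ e (tail b)) (z≰b zero) (≰-foldr e (tail b) z z≰e (z≰b ∘ suc))

≤max : ∀ {k} .{{_ : NonZero k}} (a : Vector ℝ k) i → a i ≤ᵣ max a
≤max {suc k} a zero    = base≤foldr (head a) (tail a)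
≤max {suc k} a (suc i) = ≤foldr (head a) (tail a) i

max-lub : ∀ {k} .{{_ : NonZero k}} (a : Vector ℝ k) z → (∀ i → a i ≤ᵣ z) → max a ≤ᵣ z
max-lub {suc k} a z a≤z = foldr-lub (head a) (tail a) z (a≤z zero) (a≤z ∘ suc)

≰ᵣ-max : ∀ {k} .{{_ : NonZero k}} (a : Vector ℝ k) z → (∀ i → ¬ z ≤ᵣ a i) → ¬ z ≤ᵣ max a
≰ᵣ-max {suc k} a z z≰a = ≰-foldr (head a) (tail a) z (z≰a zero) (z≰a ∘ suc)

-- Linear relations between sums of weights

-- Nonnegativity of the limit, phrased for bare rational sequences so that differences and multiples
-- need no Cauchy proof.
AlmostNonneg : (ℕ → ℚ) → Set
AlmostNonneg s = ∀ ε → 0ℚ ℚ.< ε → Eventually (λ n → 0ℚ ℚ.≤ s n ℚ.+ ε)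

almostNonneg-sum : ∀ {T} (s : Fin T → ℕ → ℚ) → (∀ t → AlmostNonneg (s t)) → AlmostNonneg (λ n → sum (λ t → s t n))
almostNonneg-sum {zero}  s s≥0 ε 0<ε = 0 , λ _ _ → p≤p+ε 0ℚ 0<ε
almostNonneg-sum {suc T} s s≥0 ε 0<ε with half 0<ε
... | η , 0<η , refl = eventually-map₂
  (λ n p q → ≤-shift (identity (s zero n) (sum (λ t → s (suc t) n)) η) (ℚ.+-mono-≤ p q))
  (s≥0 zero η 0<η) (almostNonneg-sum (s ∘ suc) (s≥0 ∘ suc) η 0<η)
  where
  identity : ∀ p q η → (p ℚ.+ q ℚ.+ (η ℚ.+ η)) ℚ.- 0ℚ ≡ ((p ℚ.+ η) ℚ.+ (q ℚ.+ η)) ℚ.- (0ℚ ℚ.+ 0ℚ)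
  identity = solve 3 (λ p q η → (p :+ q :+ (η :+ η)) :- con 0ℚ := ((p :+ η) :+ (q :+ η)) :- (con 0ℚ :+ con 0ℚ)) refl

abstract
  -- Take η = ε / (c + 1); the divisor is positive even when `c` is 0.
  shrink : ∀ c → 0ℚ ℚ.≤ c → ∀ ε → 0ℚ ℚ.< ε → ∃[ η ] (0ℚ ℚ.< η × c ℚ.* η ℚ.≤ ε)
  shrink c 0≤c ε 0<ε = η , 0<η , (begin
    c ℚ.* η                   ≤⟨ p≤p+ε (c ℚ.* η) 0<η ⟩
    c ℚ.* η ℚ.+ η             ≡⟨ factor c r ε ⟩
    ((c ℚ.+ 1ℚ) ℚ.* r) ℚ.* ε  ≡⟨ cong (ℚ._* ε) (ℚ.*-inverseʳ (c ℚ.+ 1ℚ)) ⟩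
    1ℚ ℚ.* ε                  ≡⟨ ℚ.*-identityˡ ε ⟩
    ε                         ∎)
    where
    open ℚ.≤-Reasoning
    instance
      c≥0 : ℚ.NonNegative c
      c≥0 = ℚ.nonNegative 0≤c
      c+1-pos : ℚ.Positive (c ℚ.+ 1ℚ)
      c+1-pos = ℚ.nonNeg+pos⇒pos c 1ℚ
      c+1-nonZero : ℚ.NonZero (c ℚ.+ 1ℚ)
      c+1-nonZero = ℚ.pos⇒nonZero (c ℚ.+ 1ℚ)
      r-pos : ℚ.Positive (ℚ.1/ (c ℚ.+ 1ℚ))
      r-pos = ℚ.1/pos⇒pos (c ℚ.+ 1ℚ)
      ε-pos : ℚ.Positive ε
      ε-pos = ℚ.positive 0<ε
    r : ℚ
    r = ℚ.1/ (c ℚ.+ 1ℚ)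
    η : ℚ
    η = r ℚ.* ε
    0<η : 0ℚ ℚ.< η
    0<η = ℚ.positive⁻¹ η ⦃ ℚ.pos*pos⇒pos r ε ⦄
    factor : ∀ c r ε → c ℚ.* (r ℚ.* ε) ℚ.+ r ℚ.* ε ≡ ((c ℚ.+ 1ℚ) ℚ.* r) ℚ.* ε
    factor = solve 3 (λ c r ε → c :* (r :* ε) :+ r :* ε := ((c :+ con 1ℚ) :* r) :* ε) refl

almostNonneg-* : ∀ c (s : ℕ → ℚ) → 0ℚ ℚ.≤ c → AlmostNonneg s → AlmostNonneg (λ n → c ℚ.* s n)
almostNonneg-* c s 0≤c s≥0 ε 0<ε with shrink c 0≤c ε 0<ε
... | η , 0<η , cη≤ε = eventually-map (λ n 0≤s+η → begin
    0ℚ                     ≡⟨ ℚ.*-zeroʳ c ⟨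
    c ℚ.* 0ℚ               ≤⟨ ℚ.*-monoˡ-≤-nonNeg c ⦃ ℚ.nonNegative 0≤c ⦄ 0≤s+η ⟩
    c ℚ.* (s n ℚ.+ η)      ≡⟨ ℚ.*-distribˡ-+ c (s n) η ⟩
    c ℚ.* s n ℚ.+ c ℚ.* η  ≤⟨ ℚ.+-monoʳ-≤ (c ℚ.* s n) cη≤ε ⟩
    c ℚ.* s n ℚ.+ ε        ∎)
  (s≥0 η 0<η)
  where open ℚ.≤-Reasoning

≤ᵣ⇒almostNonneg : ∀ x y → x ≤ᵣ y → AlmostNonneg (λ n → seq y n ℚ.- seq x n)
≤ᵣ⇒almostNonneg x y x≤y ε 0<ε =
  eventually-map (λ n → ≤-shift (identity (seq x n) (seq y n) ε)) (x≤y ε 0<ε)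
  where
  identity : ∀ p q ε → (q ℚ.- p ℚ.+ ε) ℚ.- 0ℚ ≡ (q ℚ.+ ε) ℚ.- p
  identity = solve 3 (λ p q ε → (q :- p :+ ε) :- con 0ℚ := (q :+ ε) :- p) refl

almostNonneg-resp : ∀ {s s′ : ℕ → ℚ} → (∀ n → s n ≡ s′ n) → AlmostNonneg s → AlmostNonneg s′
almostNonneg-resp eq s≥0 ε 0<ε = eventually-map (λ n → subst (λ p → 0ℚ ℚ.≤ p ℚ.+ ε) (eq n)) (s≥0 ε 0<ε)

≤-from-minus : ∀ {p q δ} → q ℚ.+ δ ℚ.≤ p → δ ℚ.≤ p ℚ.- q
≤-from-minus {p} {q} {δ} = ≤-shift (identity p q δ)
  where
  identity : ∀ p q δ → (p ℚ.- q) ℚ.- δ ≡ p ℚ.- (q ℚ.+ δ)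
  identity = solve 3 (λ p q δ → (p :- q) :- δ := p :- (q :+ δ)) refl

-- Under the sign conditions every term of the vanishing sum is nonnegative in the limit, while a
-- term with positive coefficient would be bounded away from 0. The strict gap of that term is known
-- only up to double negation, enough for a negative conclusion.
no-positive-relation : ∀ {T} (c : Vector ℚ (suc T)) (x y : Vector ℝ (suc T)) →
  (∀ n → sum (λ t → c t ℚ.* (seq (x t) n ℚ.- seq (y t) n)) ≡ 0ℚ) →
  (∀ t → c t ℚ.≤ 0ℚ → x t ≤ᵣ y t) → (∀ t → 0ℚ ℚ.< c t → ¬ x t ≤ᵣ y t) →
  ∀ t → ¬ 0ℚ ℚ.< c t
no-positive-relation {T} c x y sum≡0 ≤-holds ≤-fails t₀ 0<c₀ = ≤-fails t₀ 0<c₀ (≮ᵣ⇒≥ᵣ (x t₀) (y t₀) absurd)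
  where
  s : Fin (suc T) → ℕ → ℚ
  s t n = c t ℚ.* (seq (x t) n ℚ.- seq (y t) n)

  swap-signs : ∀ c p q → ℚ.- c ℚ.* (q ℚ.- p) ≡ c ℚ.* (p ℚ.- q)
  swap-signs = solve 3 (λ c p q → :- c :* (q :- p) := c :* (p :- q)) refl

  -- For c ≤ 0 both factors are negated; for c > 0 the failure of `x ≤ᵣ y` weakens to `y ≤ᵣ x`.
  s≥0 : ∀ t → AlmostNonneg (s t)
  s≥0 t with c t ℚ.≤? 0ℚ
  ... | yes c≤0 = almostNonneg-resp (λ n → swap-signs (c t) (seq (x t) n) (seq (y t) n))
    (almostNonneg-* (ℚ.- c t) _ (ℚ.neg-antimono-≤ c≤0) (≤ᵣ⇒almostNonneg (x t) (y t) (≤-holds t c≤0)))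
  ... | no  c≰0 = almostNonneg-* (c t) _ (ℚ.<⇒≤ 0<c)
    (≤ᵣ⇒almostNonneg (y t) (x t) (≰ᵣ⇒≥ᵣ (x t) (y t) (≤-fails t 0<c)))
    where 0<c = ℚ.≰⇒> c≰0

  others : ℕ → ℚ
  others n = sum (λ t → s (punchIn t₀ t) n)

  absurd : ¬ y t₀ <ᵣ x t₀
  absurd (δ , 0<δ , gap) = collide (half 0<cδ)
    where
    instance
      c₀-pos = ℚ.positive 0<c₀
      δ-pos = ℚ.positive 0<δ
    0<cδ : 0ℚ ℚ.< c t₀ ℚ.* δ
    0<cδ = ℚ.positive⁻¹ (c t₀ ℚ.* δ) ⦃ ℚ.pos*pos⇒pos (c t₀) δ ⦄

    cδ≤s₀ : Eventually (λ n → c t₀ ℚ.* δ ℚ.≤ s t₀ n)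
    cδ≤s₀ = eventually-map
      (λ n → ℚ.*-monoˡ-≤-nonNeg (c t₀) ⦃ ℚ.pos⇒nonNeg (c t₀) ⦄ ∘ ≤-from-minus {seq (x t₀) n} {seq (y t₀) n}) gap

    identity : ∀ p q η → 0ℚ ℚ.- η ≡ (p ℚ.+ (q ℚ.+ η)) ℚ.- ((η ℚ.+ η) ℚ.+ 0ℚ) ℚ.- (p ℚ.+ q)
    identity = solve 3 (λ p q η → con 0ℚ :- η := (p :+ (q :+ η)) :- ((η :+ η) :+ con 0ℚ) :- (p :+ q)) refl

    -- With cδ = 2η, the term at `t₀` is eventually at least 2η and the others sum to at least -η.
    -- Their total is 0, so η ≤ 0.
    collide : ¬ (∃[ η ] (0ℚ ℚ.< η × c t₀ ℚ.* δ ≡ η ℚ.+ η))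
    collide (η , 0<η , cδ≡2η) = ℚ.<-irrefl refl (ℚ.<-≤-trans 0<η η≤0)
      where
      both : Eventually (λ n → (η ℚ.+ η) ℚ.+ 0ℚ ℚ.≤ s t₀ n ℚ.+ (others n ℚ.+ η))
      both = eventually-map₂ (λ n p q → ℚ.+-mono-≤ (subst (ℚ._≤ s t₀ n) cδ≡2η p) q) cδ≤s₀
        (almostNonneg-sum (s ∘ punchIn t₀) (s≥0 ∘ punchIn t₀) η 0<η)
      n = proj₁ both
      total : s t₀ n ℚ.+ others n ≡ 0ℚ
      total = trans (sym (sum-remove {i = t₀} (λ t → s t n))) (sum≡0 n)
      η≤0 : η ℚ.≤ 0ℚ
      η≤0 = ≤-shift
        (trans (identity (s t₀ n) (others n) η)
          (trans (cong (λ r → (s t₀ n ℚ.+ (others n ℚ.+ η)) ℚ.- ((η ℚ.+ η) ℚ.+ 0ℚ) ℚ.- r) total) (ℚ.+-identityʳ _)))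
        (proj₂ both n ℕ.≤-refl)

χ : ∀ {N} → Subset N → Vector ℚ N
χ X v = if lookup X v then 1ℚ else 0ℚ

∑-χ : ∀ {N} (X : Subset N) (w : Vector ℝ N) n → seq (∑[ X ] w) n ≡ sum (λ v → χ X v ℚ.* seq (w v) n)
∑-χ []            w n = refl
∑-χ (inside ∷ X)  w n = cong₂ ℚ._+_ (sym (ℚ.*-identityˡ (seq (w zero) n))) (∑-χ X (w ∘ suc) n)
∑-χ (outside ∷ X) w n = trans (∑-χ X (w ∘ suc) n)
  (sym (trans (cong (ℚ._+ rest) (ℚ.*-zeroˡ (seq (w zero) n))) (ℚ.+-identityˡ rest)))
  where rest = sum (λ v → χ X v ℚ.* seq (w (suc v)) n)

∑-difference : ∀ {N} (X Y : Subset N) (w : Vector ℝ N) n →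
  seq (∑[ X ] w) n ℚ.- seq (∑[ Y ] w) n ≡ sum (λ v → (χ X v ℚ.- χ Y v) ℚ.* seq (w v) n)
∑-difference X Y w n = begin
  seq (∑[ X ] w) n ℚ.- seq (∑[ Y ] w) n
    ≡⟨ cong₂ ℚ._-_ (∑-χ X w n) (∑-χ Y w n) ⟩
  sum f ℚ.- sum g
    ≡⟨ cong (sum f ℚ.+_) (trans (neg (sum g)) (*-distribˡ-sum (ℚ.- 1ℚ) g)) ⟩
  sum f ℚ.+ sum (λ v → ℚ.- 1ℚ ℚ.* g v)
    ≡⟨ ∑-distrib-+ f (λ v → ℚ.- 1ℚ ℚ.* g v) ⟨
  sum (λ v → f v ℚ.+ ℚ.- 1ℚ ℚ.* g v)
    ≡⟨ sum-cong-≗ (λ v → collect (χ X v) (χ Y v) (seq (w v) n)) ⟩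
  sum (λ v → (χ X v ℚ.- χ Y v) ℚ.* seq (w v) n) ∎
  where
  open ≡-Reasoning
  f g : Vector ℚ _
  f v = χ X v ℚ.* seq (w v) n
  g v = χ Y v ℚ.* seq (w v) n
  neg : ∀ p → ℚ.- p ≡ ℚ.- 1ℚ ℚ.* p
  neg = solve 1 (λ p → :- p := con (ℚ.- 1ℚ) :* p) refl
  collect : ∀ p q u → p ℚ.* u ℚ.+ ℚ.- 1ℚ ℚ.* (q ℚ.* u) ≡ (p ℚ.- q) ℚ.* u
  collect = solve 3 (λ p q u → p :* u :+ con (ℚ.- 1ℚ) :* (q :* u) := (p :- q) :* u) refl

-- Exchanging the two sums turns a relation between vectors into the same relation between their
-- products with any `u`. It is applied to each term of the Cauchy sequences of the weights.
relation-transfers : ∀ {N T} (A : Fin T → Vector ℚ N) (c : Vector ℚ T) → (∀ z → sum (λ t → c t ℚ.* A t z) ≡ 0ℚ) →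
  ∀ (u : Vector ℚ N) → sum (λ t → c t ℚ.* sum (λ z → A t z ℚ.* u z)) ≡ 0ℚ
relation-transfers {N} {T} A c rel u = begin
  sum (λ t → c t ℚ.* sum (λ z → A t z ℚ.* u z))
    ≡⟨ sum-cong-≗ (λ t → trans (*-distribˡ-sum (c t) (λ z → A t z ℚ.* u z))
         (sum-cong-≗ λ z → sym (ℚ.*-assoc (c t) (A t z) (u z)))) ⟩
  sum (λ t → sum (λ z → c t ℚ.* A t z ℚ.* u z))
    ≡⟨ ∑-comm (λ t z → c t ℚ.* A t z ℚ.* u z) ⟩
  sum (λ z → sum (λ t → c t ℚ.* A t z ℚ.* u z))
    ≡⟨ sum-cong-≗ (λ z → trans (sym (*-distribʳ-sum (u z) (λ t → c t ℚ.* A t z)))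
         (trans (cong (ℚ._* u z) (rel z)) (ℚ.*-zeroˡ (u z)))) ⟩
  sum {N} (λ _ → 0ℚ)
    ≡⟨ sum-replicate-zero N ⟩
  0ℚ ∎
  where open ≡-Reasoning

-- The pattern is fixed before `w`: its bit is false exactly where the relation between the vectors
-- 1_X - 1_Y has a positive coefficient.
unrealizable-pattern : ∀ {N} (X Y : Fin (suc N) → Subset N) → ∃[ b ] (∀ (w : Vector ℝ N) →
  ¬ (∀ t → (b t ≡ true → ∑[ X t ] w ≤ᵣ ∑[ Y t ] w) × (b t ≡ false → ¬ ∑[ X t ] w ≤ᵣ ∑[ Y t ] w)))
unrealizable-pattern {N} X Y =
  let c , (t₀ , 0<c₀) , rel = dependent⁺ A in
  (λ t → does (c t ℚ.≤? 0ℚ)) , λ w h →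
    no-positive-relation c (λ t → ∑[ X t ] w) (λ t → ∑[ Y t ] w)
      (λ n → trans (sum-cong-≗ λ t → cong (c t ℚ.*_) (∑-difference (X t) (Y t) w n))
        (relation-transfers A c rel (λ v → seq (w v) n)))
      (λ t c≤0 → proj₁ (h t) (dec-true (c t ℚ.≤? 0ℚ) c≤0))
      (λ t 0<c → proj₂ (h t) (dec-false (c t ℚ.≤? 0ℚ) (λ c≤0 → ℚ.<-irrefl refl (ℚ.<-≤-trans 0<c c≤0))))
      t₀ 0<c₀
  where
  A : Fin (suc N) → Vector ℚ N
  A t z = χ (X t) z ℚ.- χ (Y t) z

-- Order types

decode : ∀ {N} → Fin (2 ^ N) → Subset N
decode z = tabulate (Inverse.to Fin.2↔Bool ∘ finToFun z)

encode : ∀ {N} → Subset N → Fin (2 ^ N)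
encode X = funToFin (Inverse.from Fin.2↔Bool ∘ lookup X)

decode∘encode : ∀ {N} (X : Subset N) → decode (encode X) ≡ X
decode∘encode X = trans
  (tabulate-cong λ v → trans
    (cong (Inverse.to Fin.2↔Bool) (Fin.finToFun-funToFin (Inverse.from Fin.2↔Bool ∘ lookup X) v))
    (Inverse.strictlyInverseˡ Fin.2↔Bool (lookup X v)))
  (tabulate∘lookup X)

decodeˡ decodeʳ : ∀ {N} → Fin (2 ^ N * 2 ^ N) → Subset N
decodeˡ {N} z = decode (proj₁ (remQuot {2 ^ N} (2 ^ N) z))
decodeʳ {N} z = decode (proj₂ (remQuot {2 ^ N} (2 ^ N) z))

decodeˡ-combine : ∀ {N} (X Y : Subset N) → decodeˡ (combine (encode X) (encode Y)) ≡ X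
decodeˡ-combine X Y =
  trans (cong (decode ∘ proj₁) (Fin.remQuot-combine (encode X) (encode Y))) (decode∘encode X)

decodeʳ-combine : ∀ {N} (X Y : Subset N) → decodeʳ (combine (encode X) (encode Y)) ≡ Y
decodeʳ-combine X Y =
  trans (cong (decode ∘ proj₂) (Fin.remQuot-combine (encode X) (encode Y))) (decode∘encode Y)

does-true⁻ : ∀ {A : Set} (a? : Dec A) → does a? ≡ true → A
does-true⁻ (yes a) _ = a

does-false⁻ : ∀ {A : Set} (a? : Dec A) → does a? ≡ false → ¬ A
does-false⁻ (no ¬a) _ = ¬a

-- Double negation commutes with finite products, so excluded middle may be assumed for finitely
-- many propositions at once.
¬¬-decidable : ∀ {m M} (P : Fin m → Fin M → Set) → ¬ ¬ (∀ r z → Dec (P r z))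
¬¬-decidable P = distribute λ r → distribute λ z → ¬¬-excluded-middle
  where
  distribute : ∀ {n} {Q : Fin n → Set} → (∀ i → ¬ ¬ Q i) → ¬ ¬ (∀ i → Q i)
  distribute = Fin.sequence (RawMonad.rawApplicative ¬¬-Monad)

SameOrder : ∀ {N} → Vector ℝ N → Vector ℝ N → Set
SameOrder w w′ = ∀ X Y → ∑[ X ] w ≤ᵣ ∑[ Y ] w → ∑[ X ] w′ ≤ᵣ ∑[ Y ] w′

additive-orders-bound : ∀ {N m} (w : Fin m → Vector ℝ N) →
  (∀ r r′ → r ≢ r′ → ¬ (SameOrder (w r) (w r′) × SameOrder (w r′) (w r))) →
  m ℕ.≤ 2 ^ (3 * (N * N))
additive-orders-bound {N} {m} w distinct =
  -- The goal is a decidable inequality of naturals, so the decisions `below?` may be extracted from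
  -- under the double negation.
  decidable-stable (m ℕ.≤? _) λ m≰ → ¬¬-decidable Below λ below? →
    m≰ (ℕ.≤-trans (patterns-bound N (belowPattern below?) (injective below?) (not-shattered below?)) (subset-pairs-bound N))
  where
  M = 2 ^ N * 2 ^ N

  Below : Fin m → Fin M → Set
  Below r z = ∑[ decodeˡ z ] (w r) ≤ᵣ ∑[ decodeʳ z ] (w r)

  module _ (below? : ∀ r z → Dec (Below r z)) where

    belowPattern : Fin m → Vec Bool M
    belowPattern r = tabulate (λ z → does (below? r z))

    lookup-pattern : ∀ r z → lookup (belowPattern r) z ≡ does (below? r z)
    lookup-pattern r = lookup∘tabulate (λ z → does (below? r z))

    same-order : ∀ r r′ → belowPattern r ≡ belowPattern r′ → SameOrder (w r) (w r′)
    same-order r r′ eq X Y = subst₂ (λ X Y → ∑[ X ] (w r) ≤ᵣ ∑[ Y ] (w r) → ∑[ X ] (w r′) ≤ᵣ ∑[ Y ] (w r′))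
      (decodeˡ-combine X Y) (decodeʳ-combine X Y) λ below → does-true⁻ (below? r′ z)
        (trans (sym (lookup-pattern r′ z)) (trans (cong (λ p → lookup p z) (sym eq))
          (trans (lookup-pattern r z) (dec-true (below? r z) below))))
      where z = combine (encode X) (encode Y)

    injective : ∀ r r′ → belowPattern r ≡ belowPattern r′ → r ≡ r′
    injective r r′ eq = decidable-stable (r Fin.≟ r′) λ r≢r′ →
      distinct r r′ r≢r′ (same-order r r′ eq , same-order r′ r (sym eq))

    not-shattered : ∀ (s : Fin (suc N) → Fin M) → ¬ (∀ b → ∃[ r ] (∀ j → lookup (belowPattern r) (s j) ≡ b j))
    not-shattered s shattered =
      let b , unrealizable = unrealizable-pattern (decodeˡ ∘ s) (decodeʳ ∘ s)
          r , realizes = shattered b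
          bit = λ t → trans (sym (lookup-pattern r (s t))) (realizes t)
      in unrealizable (w r) λ t →
        (λ bₜ → does-true⁻ (below? r (s t)) (trans (bit t) bₜ)) ,
        (λ bₜ → does-false⁻ (below? r (s t)) (trans (bit t) bₜ))

-- From `k`-XOS functions to additive functions

embed : ∀ {k n} → Fin k → Subset n → Subset (k * n)
embed zero    X = X ++ ⊥
embed (suc i) X = ⊥ ++ embed i X

∑-⊥ : ∀ {N} (w : Vector ℝ N) m → seq (∑[ ⊥ ] w) m ≡ 0ℚ
∑-⊥ {zero}  w m = refl
∑-⊥ {suc N} w m = ∑-⊥ (w ∘ suc) m

∑-++⊥ : ∀ {n p} (X : Subset n) (w : Vector ℝ (n + p)) m →
  seq (∑[ X ++ ⊥ ] w) m ≡ seq (∑[ X ] (w ∘ (_↑ˡ p))) m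
∑-++⊥ []            w m = ∑-⊥ w m
∑-++⊥ (inside  ∷ X) w m = cong (seq (w zero) m ℚ.+_) (∑-++⊥ X (w ∘ suc) m)
∑-++⊥ (outside ∷ X) w m = ∑-++⊥ X (w ∘ suc) m

∑-⊥++ : ∀ n {p} (Y : Subset p) (w : Vector ℝ (n + p)) m →
  seq (∑[ ⊥ {n} ++ Y ] w) m ≡ seq (∑[ Y ] (w ∘ (n ↑ʳ_))) m
∑-⊥++ zero    Y w m = refl
∑-⊥++ (suc n) Y w m = ∑-⊥++ n Y (w ∘ suc) m

-- `embed` and `combine` lay out the `k` blocks of length `n` in the same order, so only the weights
-- of block `i` contribute.
∑-embed : ∀ {k n} (i : Fin k) (X : Subset n) (w : Vector ℝ (k * n)) m →
  seq (∑[ embed i X ] w) m ≡ seq (∑[ X ] (w ∘ combine i)) m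
∑-embed         zero    X w m = ∑-++⊥ X w m
∑-embed {n = n} (suc i) X w m = trans (∑-⊥++ n (embed i X) w m) (∑-embed i X (w ∘ (n ↑ʳ_)) m)

∑-cong : ∀ {N} (X : Subset N) (w w′ : Vector ℝ N) m → (∀ v → w v ≡ w′ v) → seq (∑[ X ] w) m ≡ seq (∑[ X ] w′) m
∑-cong []            w w′ m w≗w′ = refl
∑-cong (inside  ∷ X) w w′ m w≗w′ =
  cong₂ ℚ._+_ (cong (λ x → seq x m) (w≗w′ zero)) (∑-cong X (w ∘ suc) (w′ ∘ suc) m (w≗w′ ∘ suc))
∑-cong (outside ∷ X) w w′ m w≗w′ = ∑-cong X (w ∘ suc) (w′ ∘ suc) m (w≗w′ ∘ suc)

-- No maximizing index is chosen. If `a′ i` were not below `max b′`, then by `h` no `b j` would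
-- bound `a i`, so neither would `max b`, against `a i ≤ᵣ max a ≤ᵣ max b`.
max-mono : ∀ {k} .{{_ : NonZero k}} (a b a′ b′ : Vector ℝ k) →
  (∀ i j → a i ≤ᵣ b j → a′ i ≤ᵣ b′ j) → max a ≤ᵣ max b → max a′ ≤ᵣ max b′
max-mono a b a′ b′ h max≤max = max-lub a′ (max b′) λ i → ≤ᵣ-stable (a′ i) (max b′) λ a′ᵢ≰ →
  ≰ᵣ-max b (a i)
    (λ j aᵢ≤bⱼ → a′ᵢ≰ (≤ᵣ-trans (a′ i) (b′ j) (max b′) (h i j aᵢ≤bⱼ) (≤max b′ j)))
    (≤ᵣ-trans (a i) (max a) (max b) (≤max a i) max≤max)

weights : ∀ {k n} → (Fin k → SetFunction n) → Vector ℝ (k * n)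
weights {n = n} fs z = let i , v = remQuot n z in fs i ⁅ v ⁆

≃ᵣ-trans : ∀ x y z → x ≃ᵣ y → y ≃ᵣ z → x ≃ᵣ z
≃ᵣ-trans x y z (x≤y , y≤x) (y≤z , z≤y) = ≤ᵣ-trans x y z x≤y y≤z , ≤ᵣ-trans z y x z≤y y≤x

pointwise⇒≃ᵣ : ∀ x y → (∀ m → seq x m ≡ seq y m) → x ≃ᵣ y
pointwise⇒≃ᵣ x y x≗y = pointwise⇒≤ᵣ x y (ℚ.≤-reflexive ∘ x≗y) , pointwise⇒≤ᵣ y x (ℚ.≤-reflexive ∘ sym ∘ x≗y)

∑-weights : ∀ {k n} (fs : Fin k → SetFunction n) → (∀ i → Additive (fs i)) →
  ∀ i X → fs i X ≃ᵣ ∑[ embed i X ] (weights fs)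
∑-weights fs additive i X = ≃ᵣ-trans (fs i X) (∑[ X ] row) (∑[ embed i X ] (weights fs)) (additive i X)
  (pointwise⇒≃ᵣ (∑[ X ] row) (∑[ embed i X ] (weights fs)) λ m → sym (trans (∑-embed i X (weights fs) m)
    (∑-cong X (weights fs ∘ combine i) row m λ v →
      cong (uncurry λ i v → fs i ⁅ v ⁆) (Fin.remQuot-combine i v))))
  where
  row = λ v → fs i ⁅ v ⁆

≤ᵣ-resp-≃ᵣ : ∀ x x′ y y′ → x ≃ᵣ x′ → y ≃ᵣ y′ → x ≤ᵣ y → x′ ≤ᵣ y′
≤ᵣ-resp-≃ᵣ x x′ y y′ (_ , x′≤x) (y≤y′ , _) x≤y = ≤ᵣ-trans x′ y y′ (≤ᵣ-trans x′ x y x′≤x x≤y) y≤y′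

XOS-weights : ∀ {k} .{{_ : NonZero k}} {n} (f : SetFunction n) → XOS k f → Vector ℝ (k * n)
XOS-weights f (fs , _) = weights fs

-- `max-mono` needs comparisons between different components `fs i` and `fs j`. Placing all
-- components in one weight vector makes these comparisons of two subsets under a single additive
-- function.
XOS-order : ∀ {k} .{{_ : NonZero k}} {n} (f g : SetFunction n) (F : XOS k f) (G : XOS k g) →
  SameOrder (XOS-weights f F) (XOS-weights g G) → ∀ X Y → f X ≤ᵣ f Y → g X ≤ᵣ g Y
XOS-order f g (fs , fs-additive , f≃max) (gs , gs-additive , g≃max) same X Y fX≤fY =
  ≤ᵣ-resp-≃ᵣ (max gs⟨ X ⟩) (g X) (max gs⟨ Y ⟩) (g Y) (swap (g≃max X)) (swap (g≃max Y))
    (max-mono fs⟨ X ⟩ fs⟨ Y ⟩ gs⟨ X ⟩ gs⟨ Y ⟩ componentwise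
      (≤ᵣ-resp-≃ᵣ (f X) (max fs⟨ X ⟩) (f Y) (max fs⟨ Y ⟩) (f≃max X) (f≃max Y) fX≤fY))
  where
  fs⟨_⟩ gs⟨_⟩ : Subset _ → Vector ℝ _
  fs⟨ X ⟩ i = fs i X
  gs⟨ X ⟩ i = gs i X
  f∑ g∑ : ∀ i X → ℝ
  f∑ i X = ∑[ embed i X ] (weights fs)
  g∑ i X = ∑[ embed i X ] (weights gs)
  componentwise : ∀ i j → fs i X ≤ᵣ fs j Y → gs i X ≤ᵣ gs j Y
  componentwise i j fᵢX≤fⱼY =
    ≤ᵣ-resp-≃ᵣ (g∑ i X) (gs i X) (g∑ j Y) (gs j Y)
      (swap (∑-weights gs gs-additive i X)) (swap (∑-weights gs gs-additive j Y))
      (same (embed i X) (embed j Y)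
        (≤ᵣ-resp-≃ᵣ (fs i X) (f∑ i X) (fs j Y) (f∑ j Y)
          (∑-weights fs fs-additive i X) (∑-weights fs fs-additive j Y) fᵢX≤fⱼY))

theorem22 : ∃[ c ] (∀ (k n : ℕ) → .{{_ : NonZero k}} → AtMostOrderDifferent {n} (2 ^ (c * (k ^ 2 * n ^ 2))) (XOS k))
-- The constant 3 is that of `subset-pairs-bound`, used with N = k n.
theorem22 = 3 , λ k n m f xos different →
  subst (λ e → m ℕ.≤ 2 ^ (3 * e)) (square k n)
    (additive-orders-bound (λ r → XOS-weights (f r) (xos r)) λ r r′ r≢r′ (same , same′) →
      different r r′ r≢r′ λ X Y → mk⇔
        (XOS-order (f r) (f r′) (xos r) (xos r′) same X Y)
        (XOS-order (f r′) (f r) (xos r′) (xos r) same′ X Y))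
  where
  square : ∀ k n → k * n * (k * n) ≡ k * (k * 1) * (n * (n * 1))
  square = solve-∀
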